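{- For every integer $n\geq 1$, $$\sum_{\sigma \in \mathrm{PRW}_{n+1}}u^{\mathrm{M}(\sigma)}v^{\mathrm{des}(\sigma)}w^{\mathrm{asc}(\sigma)}\alpha^{\mathrm{LRmin}(\sigma)+\mathrm{RLmin}(\sigma)-2} =\sum_{\sigma \in \mathrm{PRW}_{n+1}}x^{\mathrm{des}(\sigma)}y^{\mathrm{asc}(\sigma)}\alpha^{\mathrm{LRmin}(\sigma)+\mathrm{RLmin}(\sigma)-2},$$ where $$x=\frac{(w+v)-\sqrt{(w+v)^2-4uvw}}{2}\quad\text{and}\quad y=\frac{(w+v)+\sqrt{(w+v)^2-4uvw}}{2}.$$
   Context: $\mathfrak{S}_n$ is the set of permutations $\sigma=\sigma_1\cdots\sigma_n$ of $[n]=\{1,\dots,n\}$. An index $i\in[n-1]$ is a descent (resp. ascent) of $\sigma$ if $\sigma_i>\sigma_{i+1}$ (resp. $\sigma_i<\sigma_{i+1}$); $\mathrm{des}(\sigma)$ and $\mathrm{asc}(\sigma)$ are the numbers of descents and ascents. $\mathrm{PRW}_n$ is the set of $\pi\in\mathfrak{S}_n$ such that the first ascent (if any) of $\pi$ appears at the letter $1$; i.e., if $\pi$ has an ascent and $i$ is the smallest one, then $\pi_i=1$. A left-to-right minimum (resp. right-to-left minimum) of $\sigma\in\mathfrak{S}_n$ is a letter $\sigma_i$ such that $\sigma_j>\sigma_i$ for every $j<i$ (resp. every $j>i$); $\mathrm{LRmin}(\sigma)$ and $\mathrm{RLmin}(\sigma)$ are the numbers of these. With the convention $\sigma_0=\sigma_{n+1}=+\infty$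 for $\sigma\in\mathfrak{S}_n$, a value $\sigma_i$ ($1\le i\le n$) is a peak if $\sigma_{i-1}<\sigma_i>\sigma_{i+1}$; $\mathrm{M}(\sigma)$ is the number of peaks of $\sigma$. In the formulas for $x$ and $y$, the same (fixed) square root of $(w+v)^2-4uvw$ is used. -}

module Defs where

open import Algebra.Bundles using (CommutativeRing)
import Algebra.Properties.Semiring.Exp as Exp
import Algebra.Properties.Semiring.Mult as Mult
open import Data.Fin.Base using (Fin; zero; suc; inject₁; _<_; _>_)
open import Data.Fin.Properties using (_≟_; _<?_; all?)
open import Data.List.Base as List using (List; filter; cartesianProductWith)
open import Data.Nat.Base using (ℕ; zero; suc; NonZero)
open import Data.Product.Base using (_×_)
open import Data.Vec.Base as Vec using (Vec; []; _∷_; _∷ʳ_; lookup; count)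
open import Data.Vec.Relation.Unary.AllPairs using (allPairs?)
open import Data.Vec.Relation.Unary.Unique.Propositional using (Unique)
open import Level using (0ℓ)
open import Relation.Binary.Construct.Add.Supremum.Strict using (_<⁺_; <⁺-dec)
open import Relation.Binary.PropositionalEquality.Core using (_≡_)
open import Relation.Nullary.Construct.Add.Supremum using (_⁺; ⊤⁺; [_])
open import Relation.Nullary.Decidable.Core using (¬?; _×-dec_; _→-dec_)
open import Relation.Nullary.Negation.Core using (¬_)
open import Relation.Unary using (Pred; Decidable)

-- Positions and letters are both shifted down by one: Fin n stands for
-- [n] = {1,…,n}, so the letter 1 is `zero`.
Word : ℕ → Set
Word n = Vec (Fin n) n

-- The permutations of [n] are the words of length n on [n] with
-- pairwise distinct letters.
IsPermutation : ∀ {n} → Pred (Word n) 0ℓ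
IsPermutation = Unique

isPermutation? : ∀ {n} → Decidable (IsPermutation {n})
isPermutation? = allPairs? (λ a b → ¬? (a ≟ b))

-- All words of length k on the alphabet [n], each listed once.
allWords : ∀ k n → List (Vec (Fin n) k)
allWords zero    n = List.[ [] ]
allWords (suc k) n = cartesianProductWith _∷_ (List.allFin n) (allWords k n)

𝔖 : ∀ n → List (Word n)
𝔖 n = filter isPermutation? (allWords n n)

#[_] : ∀ {n} {P : Pred (Fin n) 0ℓ} → Decidable P → ℕ
#[ P? ] = count P? (Vec.allFin _)

-- For a word of length m + 1, the indices i ∈ [m] are represented by Fin m:
-- `inject₁ i` is the position i and `suc i` the position i + 1.
module _ {m : ℕ} (σ : Word (suc m)) where

  Descent : Pred (Fin m) 0ℓ
  Descent i = lookup σ (inject₁ i) > lookup σ (suc i)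

  Ascent : Pred (Fin m) 0ℓ
  Ascent i = lookup σ (inject₁ i) < lookup σ (suc i)

  descent? : Decidable Descent
  descent? i = lookup σ (suc i) <? lookup σ (inject₁ i)

  ascent? : Decidable Ascent
  ascent? i = lookup σ (inject₁ i) <? lookup σ (suc i)

  des : ℕ
  des = #[ descent? ]

  asc : ℕ
  asc = #[ ascent? ]

  FirstAscent : Pred (Fin m) 0ℓ
  FirstAscent i = Ascent i × (∀ j → j < i → ¬ Ascent j)

  firstAscent? : Decidable FirstAscent
  firstAscent? i =
    ascent? i ×-dec all? (λ j → (j <? i) →-dec ¬? (ascent? j))

FirstAscentAt1 : ∀ {m} → Pred (Word (suc m)) 0ℓ
FirstAscentAt1 σ = ∀ i → FirstAscent σ i → lookup σ (inject₁ i) ≡ zero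

firstAscentAt1? : ∀ {m} → Decidable (FirstAscentAt1 {m})
firstAscentAt1? σ =
  all? (λ i → firstAscent? σ i →-dec (lookup σ (inject₁ i) ≟ zero))

PRW : ∀ n → .{{NonZero n}} → List (Word n)
PRW (suc m) = filter firstAscentAt1? (𝔖 (suc m))

-- The letters of a permutation are distinct, so counting letters with a given
-- property amounts to counting their positions.
module _ {n : ℕ} (σ : Word n) where

  IsLRmin : Pred (Fin n) 0ℓ
  IsLRmin i = ∀ j → j < i → lookup σ j > lookup σ i

  IsRLmin : Pred (Fin n) 0ℓ
  IsRLmin i = ∀ j → j > i → lookup σ j > lookup σ i

  isLRmin? : Decidable IsLRmin
  isLRmin? i = all? (λ j → (j <? i) →-dec (lookup σ i <? lookup σ j))

  isRLmin? : Decidable IsRLmin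
  isRLmin? i = all? (λ j → (i <? j) →-dec (lookup σ i <? lookup σ j))

  LRmin : ℕ
  LRmin = #[ isLRmin? ]

  RLmin : ℕ
  RLmin = #[ isRLmin? ]

  -- σ₀ σ₁ ⋯ σₙ σₙ₊₁ with σ₀ = σₙ₊₁ = +∞; here the indices are not shifted.
  padded : Vec (Fin n ⁺) (suc (suc n))
  padded = ⊤⁺ ∷ (Vec.map [_] σ ∷ʳ ⊤⁺)

  -- The three positions looked up are i - 1, i and i + 1, for i ∈ [n].
  IsPeak : Pred (Fin n) 0ℓ
  IsPeak i =
    _<⁺_ _<_ (lookup padded (inject₁ (inject₁ i))) (lookup padded (suc (inject₁ i)))
    × _<⁺_ _<_ (lookup padded (suc (suc i))) (lookup padded (suc (inject₁ i)))

  isPeak? : Decidable IsPeak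
  isPeak? i = <⁺-dec _<_ _<?_ _ _ ×-dec <⁺-dec _<_ _<?_ _ _

  M : ℕ
  M = #[ isPeak? ]

module RingNotation {c ℓ} (R : CommutativeRing c ℓ) where

  open CommutativeRing R public
  open Exp semiring public using (_^_)
  -- k · a = a + ⋯ + a (k summands)
  open Mult semiring public using () renaming (_×_ to _·_)

  ∑ : ∀ {a} {A : Set a} → List A → (A → Carrier) → Carrier
  ∑ xs f = List.foldr (λ a s → f a + s) 0# xs

  infix 5 ∑
  syntax ∑ xs (λ σ → e) = ∑[ σ ∈ xs ] e

{-# OPTIONS --safe #-}

-- Both sides are values of F(u,v,w) = ∑ u^M v^des w^asc α^(LRmin+RLmin-2), the
-- right one at (1,x,y), so it suffices that F depends only on w + v and u v w.
-- Write the elements of PRW as D 1 R with D decreasing, and give each letter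
-- of D the weight t = α v, each ascent and descent of 1 R that meet at a peak
-- the joint weight p = u v w, and every other step w or v.  Inserting a new
-- largest letter in front contributes t, at the end α w, and in an inner gap
-- of 1 R it turns w or v into p, or p into p w or p v.  So the insertions act on
-- weights as S + ∂, where S = t + α w and ∂ is the derivation with
-- ∂w = ∂v = p, ∂p = p (w + v) and ∂t = ∂α = 0.  Hence ∂S = α p and
-- ∂(w + v) = 2 p, so the polynomials in S = α (w + v), w + v, p and α are
-- preserved, and F for PRW (n + 1) is (S + ∂)ⁿ 1.
module Submission where

open import Defs
open import Algebra.Bundles using (CommutativeRing)
open import Data.Bool.Base using (Bool; true; false; if_then_else_; _∧_; T)
open import Data.Bool.Properties using (T?; T-∧)
open import Data.Fin.Base as Fin using (Fin; zero; suc; toℕ; inject₁; fromℕ; lower₁; _<_; _>_)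
import Data.Fin.Properties as Fin
open import Data.List.Base as List using (List; []; _∷_; cartesianProductWith; filter; _++_)
open import Data.List.Membership.Propositional using (_∈_)
open import Data.List.Membership.Propositional.Properties
  using (∈-cartesianProductWith⁺; ∈-cartesianProductWith⁻; ∈-allFin; ∈-filter⁺; ∈-filter⁻)
open import Data.List.Membership.Propositional.Properties.WithK using (unique∧set⇒bag)
open import Data.List.Properties using (map-tabulate; foldr-map)
open import Data.List.Relation.Binary.BagAndSetEquality using (∼bag⇒↭)
open import Data.List.Relation.Binary.Permutation.Propositional as ↭ using (_↭_)
import Data.List.Relation.Unary.All as LAll
import Data.List.Relation.Unary.AllPairs as LPairs
import Data.List.Relation.Unary.Any as Any
import Data.List.Relation.Unary.Unique.Propositional as LUnique
import Data.List.Relation.Unary.Unique.Propositional.Properties as LUnique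
open import Data.Nat.Base as ℕ using (ℕ; zero; suc; pred; _∸_; _<ᵇ_; z<s; s<s; s<s⁻¹)
import Data.Nat.Properties as ℕ
open import Data.Product.Base using (∃; ∃₂; _×_; _,_; proj₁; proj₂)
open import Data.Sum.Base using (_⊎_; inj₁; inj₂)
open import Data.Vec.Base as Vec
  using (Vec; []; _∷_; _∷ʳ_; lookup; insertAt; removeAt; tabulate)
open import Data.Vec.Properties as Vec
  using (∷-injective; tabulate∘lookup; lookup-map; insertAt-removeAt; removeAt-insertAt)
open import Data.Vec.Relation.Unary.All using (All; []; _∷_)
import Data.Vec.Relation.Unary.All.Properties as All
open import Data.Vec.Relation.Unary.AllPairs using ([]; _∷_)
open import Data.Vec.Relation.Unary.Unique.Propositional using (Unique)
import Data.Vec.Relation.Unary.Unique.Propositional.Properties as Unique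
open import Function.Base using (_∘_; id)
open import Function.Bundles using (_⇔_; mk⇔; Equivalence)
open import Level using (0ℓ)
open import Relation.Binary.Construct.Add.Supremum.Strict using (<⁺-dec)
open import Relation.Binary.Definitions using (tri<; tri≈; tri>)
open import Relation.Binary.PropositionalEquality as ≡ using (_≡_; _≢_)
open import Relation.Nullary using (Dec; does; yes; no; ¬_; contradiction; _→-dec_)
open import Relation.Nullary.Construct.Add.Supremum using (_⁺; ⊤⁺; [_])
open import Relation.Nullary.Decidable using (does-⇔; dec-true; dec-false)
open import Relation.Unary using (Pred; Decidable)

-- Insertion of the largest letter into a permutation

module _ {a p} {A : Set a} {P : Pred A p} where

  All-insertAt⁺ : ∀ {n} {xs : Vec A n} i {v} → P v → All P xs → All P (insertAt xs i v)
  All-insertAt⁺ zero    pv ps       = pv ∷ ps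
  All-insertAt⁺ (suc i) pv (p ∷ ps) = p ∷ All-insertAt⁺ i pv ps

  All-insertAt⁻ : ∀ {n} (xs : Vec A n) i {v} → All P (insertAt xs i v) → P v × All P xs
  All-insertAt⁻ xs       zero    (pv ∷ ps) = pv , ps
  All-insertAt⁻ (x ∷ xs) (suc i) (p ∷ ps)  =
    let pv , ps′ = All-insertAt⁻ xs i ps in pv , p ∷ ps′

module _ {a} {A : Set a} where

  unique-insertAt⁺ : ∀ {n} {xs : Vec A n} i {v} →
                     All (v ≢_) xs → Unique xs → Unique (insertAt xs i v)
  unique-insertAt⁺ zero    v∉         u        = v∉ ∷ u
  unique-insertAt⁺ (suc i) (v≢x ∷ v∉) (x∉ ∷ u) =
    All-insertAt⁺ i (v≢x ∘ ≡.sym) x∉ ∷ unique-insertAt⁺ i v∉ u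

  unique-insertAt⁻ : ∀ {n} (xs : Vec A n) i {v} →
                     Unique (insertAt xs i v) → All (v ≢_) xs × Unique xs
  unique-insertAt⁻ xs       zero    (v∉ ∷ u) = v∉ , u
  unique-insertAt⁻ (x ∷ xs) (suc i) (x∉ ∷ u) =
    let x≢v , x∉xs = All-insertAt⁻ xs i x∉
        v∉xs , u′  = unique-insertAt⁻ xs i u
    in (x≢v ∘ ≡.sym) ∷ v∉xs , x∉xs ∷ u′

  lookup-injective⇒unique : ∀ {n} {xs : Vec A n} →
                            (∀ i j → lookup xs i ≡ lookup xs j → i ≡ j) → Unique xs
  lookup-injective⇒unique {xs = xs} inj =
    ≡.subst Unique (tabulate∘lookup xs) (Unique.tabulate⁺ (inj _ _))

  unique-map⁻ : ∀ {b} {B : Set b} (f : A → B) {n} {xs : Vec A n} →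
                Unique (Vec.map f xs) → Unique xs
  unique-map⁻ f {xs = xs} u = lookup-injective⇒unique λ i j eq →
    Unique.lookup-injective u i j
      (≡.trans (lookup-map i f xs) (≡.trans (≡.cong f eq) (≡.sym (lookup-map j f xs))))

-- Once the largest letter has been removed, this brings the remaining word back to the smaller
-- alphabet.
lowerAll : ∀ {n k} {xs : Vec (Fin (suc n)) k} → All (fromℕ n ≢_) xs →
           ∃ λ (ys : Vec (Fin n) k) → Vec.map inject₁ ys ≡ xs
lowerAll []                  = [] , ≡.refl
lowerAll {n} {xs = x ∷ _} (N≢x ∷ N∉) =
  let ys , eq = lowerAll N∉
      n≢x     = λ n≡x → N≢x (Fin.toℕ-injective (≡.trans (Fin.toℕ-fromℕ n) n≡x))
  in lower₁ x n≢x ∷ ys , ≡.cong₂ _∷_ (Fin.inject₁-lower₁ x n≢x) eq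

insertMax : ∀ {n} → Word n → Fin (suc n) → Word (suc n)
insertMax {n} σ i = insertAt (Vec.map inject₁ σ) i (fromℕ n)

max∉inject₁ : ∀ {n k} (ys : Vec (Fin n) k) → All (fromℕ n ≢_) (Vec.map inject₁ ys)
max∉inject₁ []       = []
max∉inject₁ (y ∷ ys) = Fin.fromℕ≢inject₁ ∷ max∉inject₁ ys

-- Pigeonhole: without the largest letter, σ would lower to n + 1 distinct letters of an alphabet of
-- size n.
max∈permutation : ∀ {n} {σ : Word (suc n)} → IsPermutation σ → ∃ λ i → lookup σ i ≡ fromℕ n
max∈permutation {n} {σ} u with Fin.any? (λ i → lookup σ i Fin.≟ fromℕ n)
... | yes i∈ = i∈
... | no  ∉  with lowerAll {xs = σ} (All.lookup⁻ λ i eq → ∉ (i , ≡.sym eq))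
...   | τ , ≡.refl = contradiction
          (Fin.injective⇒≤ (λ {i} {j} → Unique.lookup-injective (unique-map⁻ inject₁ {xs = τ} u) i j))
          (ℕ.<-irrefl ≡.refl)

insertMax-permutation : ∀ {n} {σ : Word n} i → IsPermutation σ → IsPermutation (insertMax σ i)
insertMax-permutation {σ = σ} i u =
  unique-insertAt⁺ i (max∉inject₁ σ) (Unique.map⁺ Fin.inject₁-injective u)

-- The largest letter is located and removed; by distinctness the rest avoids it and hence lowers to
-- a permutation.
insertMax-surjective : ∀ {n} {σ : Word (suc n)} → IsPermutation σ →
                       ∃₂ λ τ i → IsPermutation τ × σ ≡ insertMax τ i
insertMax-surjective {n} {σ} u
  with i , σᵢ≡n ← max∈permutation u
  with eq ← ≡.trans (≡.cong (insertAt (removeAt σ i) i) (≡.sym σᵢ≡n)) (insertAt-removeAt σ i)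
  with N∉ , u′ ← unique-insertAt⁻ (removeAt σ i) i (≡.subst Unique (≡.sym eq) u)
  with τ , eq′ ← lowerAll N∉
  = τ , i , unique-map⁻ inject₁ (≡.subst Unique (≡.sym eq′) u′)
  , ≡.sym (≡.trans (≡.cong (λ xs → insertAt xs i (fromℕ n)) eq′) eq)

map-inject₁-injective : ∀ {n k} {xs ys : Vec (Fin n) k} →
                        Vec.map inject₁ xs ≡ Vec.map inject₁ ys → xs ≡ ys
map-inject₁-injective {xs = []}     {[]}     _  = ≡.refl
map-inject₁-injective {xs = _ ∷ _} {_ ∷ _} eq =
  ≡.cong₂ _∷_ (Fin.inject₁-injective (proj₁ (∷-injective eq)))
            (map-inject₁-injective (proj₂ (∷-injective eq)))

-- Since v occurs only once in either word, its position can be read off.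
insertAt-position : ∀ {a} {A : Set a} {n} {xs ys : Vec A n} {v i j} →
                    All (v ≢_) xs → All (v ≢_) ys → insertAt xs i v ≡ insertAt ys j v → i ≡ j
insertAt-position {i = zero}  {zero}  _ _ _ = ≡.refl
insertAt-position {ys = _ ∷ _} {i = zero}  {suc j} _ (v≢y ∷ _) eq =
  contradiction (proj₁ (∷-injective eq)) v≢y
insertAt-position {xs = _ ∷ _} {i = suc i} {zero}  (v≢x ∷ _) _ eq =
  contradiction (≡.sym (proj₁ (∷-injective eq))) v≢x
insertAt-position {xs = _ ∷ _} {_ ∷ _} {i = suc i} {suc j} (_ ∷ v∉xs) (_ ∷ v∉ys) eq =
  ≡.cong suc (insertAt-position v∉xs v∉ys (proj₂ (∷-injective eq)))

insertMax-injective : ∀ {n} {σ τ : Word n} {i j} →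
                      insertMax σ i ≡ insertMax τ j → σ ≡ τ × i ≡ j
insertMax-injective {σ = σ} {τ} {i} eq
  with ≡.refl ← insertAt-position (max∉inject₁ σ) (max∉inject₁ τ) eq
  = map-inject₁-injective
      (≡.trans (≡.sym (removeAt-insertAt _ i _)) (≡.trans (≡.cong (λ xs → removeAt xs i) eq) (removeAt-insertAt _ i _)))
  , ≡.refl

-- Enumeration of the permutations by insertion of the largest letter

∈-allWords : ∀ {k n} (xs : Vec (Fin n) k) → xs ∈ allWords k n
∈-allWords []       = Any.here ≡.refl
∈-allWords (x ∷ xs) = ∈-cartesianProductWith⁺ _∷_ (∈-allFin x) (∈-allWords xs)

allWords-unique : ∀ k n → LUnique.Unique (allWords k n)
allWords-unique zero    n = LAll.[] LPairs.∷ LPairs.[]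
allWords-unique (suc k) n =
  LUnique.cartesianProductWith⁺ _∷_ ∷-injective (LUnique.allFin⁺ n) (allWords-unique k n)

𝔖-unique : ∀ n → LUnique.Unique (𝔖 n)
𝔖-unique n = LUnique.filter⁺ isPermutation? (allWords-unique n n)

∈-𝔖⁺ : ∀ {n} {σ : Word n} → IsPermutation σ → σ ∈ 𝔖 n
∈-𝔖⁺ {σ = σ} = ∈-filter⁺ isPermutation? (∈-allWords σ)

∈-𝔖⁻ : ∀ {n} {σ : Word n} → σ ∈ 𝔖 n → IsPermutation σ
∈-𝔖⁻ {n} = proj₂ ∘ ∈-filter⁻ isPermutation? {xs = allWords n n}

-- Both lists are free of repetitions and have the same members, so they agree as bags.
𝔖-suc : ∀ n → 𝔖 (suc n) ↭ cartesianProductWith insertMax (𝔖 n) (List.allFin (suc n))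
𝔖-suc n = ∼bag⇒↭ (unique∧set⇒bag (𝔖-unique (suc n))
  (LUnique.cartesianProductWith⁺ insertMax insertMax-injective (𝔖-unique n) (LUnique.allFin⁺ (suc n)))
  (mk⇔ to from))
  where
  to : ∀ {σ} → σ ∈ 𝔖 (suc n) → σ ∈ cartesianProductWith insertMax (𝔖 n) (List.allFin (suc n))
  to σ∈ with τ , i , u , ≡.refl ← insertMax-surjective (∈-𝔖⁻ σ∈) =
    ∈-cartesianProductWith⁺ insertMax (∈-𝔖⁺ u) (∈-allFin i)
  from : ∀ {σ} → σ ∈ cartesianProductWith insertMax (𝔖 n) (List.allFin (suc n)) → σ ∈ 𝔖 (suc n)
  from σ∈ with τ , i , τ∈ , _ , ≡.refl ← ∈-cartesianProductWith⁻ insertMax (𝔖 n) (List.allFin (suc n)) σ∈ =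
    ∈-𝔖⁺ (insertMax-permutation i (∈-𝔖⁻ τ∈))

-- The derivation and its iterates

module Derivation {c ℓ} (R : CommutativeRing c ℓ) where

  open RingNotation R hiding (zero)
  open import Algebra.Properties.Semiring.Exp semiring using (^-congˡ)
  open import Algebra.Solver.Ring.NaturalCoefficients.Default commutativeSemiring
    using (solve; _:=_; _:+_; _:*_; con)
  open import Relation.Binary.Reasoning.Setoid setoid

  ⟦_⟧ : ℕ → Carrier
  ⟦ m ⟧ = m · 1#

  -- The factor `⟦ m ⟧` vanishes at m = 0, so terms that involve `pred m` need to be compared at
  -- successors only.
  pred-cong : ∀ m {f : ℕ → Carrier} {g : Carrier} → (∀ i → m ≡ suc i → f (suc i) ≈ g) →
              ⟦ m ⟧ * f m ≈ ⟦ m ⟧ * g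
  pred-cong zero    _  = trans (zeroˡ _) (sym (zeroˡ _))
  pred-cong (suc i) eq = *-congˡ (eq i ≡.refl)

  -- For the derivation ∂ with ∂S = α p, ∂s = 2 p, ∂w = ∂v = p, ∂p = s p and
  -- ∂α = 0, this is (S + ∂)ⁿ (Sᵃ sᵇ wⁱ vʲ pᵏ).  The junk terms at pred 0 have coefficient 0.
  iter : (α S s w v p : Carrier) → ℕ → (a b i j k : ℕ) → Carrier
  iter α S s w v p zero    a b i j k = S ^ a * s ^ b * w ^ i * v ^ j * p ^ k
  iter α S s w v p (suc n) a b i j k =
      I (suc a) b i j k
    + ⟦ a ⟧ * (α * I (pred a) b i j (suc k))
    + ⟦ b ⟧ * (I a (pred b) i j (suc k) + I a (pred b) i j (suc k))
    + ⟦ i ⟧ * I a b (pred i) j (suc k)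
    + ⟦ j ⟧ * I a b i (pred j) (suc k)
    + ⟦ k ⟧ * I a (suc b) i j k
    where I = iter α S s w v p n

  -- For i = j = 0 the coefficients of ∂w and ∂v vanish, and no other term raises i or j. So w and v
  -- never enter, which is the invariance behind the theorem.
  iter-cong : ∀ {α S S′ s s′ w w′ v v′ p p′} → S ≈ S′ → s ≈ s′ → p ≈ p′ → ∀ n a b k →
              iter α S s w v p n a b 0 0 k ≈ iter α S′ s′ w′ v′ p′ n a b 0 0 k
  iter-cong {α} {S} {S′} {s} {s′} {w} {w′} {v} {v′} {p} {p′} S≈ s≈ p≈ = go
    where
    go : ∀ n a b k → iter α S s w v p n a b 0 0 k ≈ iter α S′ s′ w′ v′ p′ n a b 0 0 k
    go zero    a b k =
      *-cong (*-congʳ (*-congʳ (*-cong (^-congˡ a S≈) (^-congˡ b s≈)))) (^-congˡ k p≈)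
    go (suc n) a b k =
      +-cong (+-cong (+-cong (+-cong (+-cong
        (go n (suc a) b k)
        (*-congˡ (*-congˡ (go n (pred a) b (suc k)))))
        (*-congˡ (+-cong (go n a (pred b) (suc k)) (go n a (pred b) (suc k)))))
        (trans (zeroˡ _) (sym (zeroˡ _))))
        (trans (zeroˡ _) (sym (zeroˡ _))))
        (*-congˡ (go n a (suc b) k))

  module _ {α S s w v p t : Carrier} (S≈ : S ≈ t + α * w) (s≈ : s ≈ w + v) where

    private I = iter α S s w v p

    -- `iter` treats S, s, w, v and p as independent variables. The relation S = t + α w is
    -- respected because both sides have the derivative α p, with t and α constant.
    iter-S : ∀ n a b i j k → I n (suc a) b i j k ≈ t * I n a b i j k + α * I n a b (suc i) j k
    iter-S zero a b i j k = begin
      S * S ^ a * s ^ b * w ^ i * v ^ j * p ^ k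
        ≈⟨ *-congʳ (*-congʳ (*-congʳ (*-congʳ (*-congʳ S≈)))) ⟩
      (t + α * w) * S ^ a * s ^ b * w ^ i * v ^ j * p ^ k
        ≈⟨ solve 8 (λ t α w Sᵃ sᵇ wⁱ vʲ pᵏ →
             (t :+ α :* w) :* Sᵃ :* sᵇ :* wⁱ :* vʲ :* pᵏ :=
             t :* (Sᵃ :* sᵇ :* wⁱ :* vʲ :* pᵏ) :+ α :* (Sᵃ :* sᵇ :* (w :* wⁱ) :* vʲ :* pᵏ))
             refl t α w (S ^ a) (s ^ b) (w ^ i) (v ^ j) (p ^ k) ⟩
      _ ∎
    iter-S (suc n) a b i j k = begin
      I n (suc (suc a)) b i j k
      + (1# + ⟦ a ⟧) * (α * I n a b i j (suc k))
      + ⟦ b ⟧ * (I n (suc a) (pred b) i j (suc k) + I n (suc a) (pred b) i j (suc k))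
      + ⟦ i ⟧ * I n (suc a) b (pred i) j (suc k)
      + ⟦ j ⟧ * I n (suc a) b i (pred j) (suc k)
      + ⟦ k ⟧ * I n (suc a) (suc b) i j k
        ≈⟨ +-cong (+-cong (+-cong (+-cong (+-cong
             (iter-S n (suc a) b i j k)
             (trans (distribʳ _ _ _) (+-cong (*-identityˡ _)
               (pred-cong a {λ a → α * I n a b i j (suc k)} λ { a′ ≡.refl → *-congˡ (iter-S n a′ b i j (suc k)) }))))
             (*-congˡ (+-cong (iter-S n a (pred b) i j (suc k)) (iter-S n a (pred b) i j (suc k)))))
             (pred-cong i {λ i → I n (suc a) b (pred i) j (suc k)}
               λ { i′ ≡.refl → iter-S n a b i′ j (suc k) }))
             (*-congˡ (iter-S n a b i (pred j) (suc k))))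
             (*-congˡ (iter-S n a (suc b) i j k)) ⟩
      t * x₁ + α * y₁
      + (α * x₀ + ⟦ a ⟧ * (α * (t * x₂ + α * y₂)))
      + ⟦ b ⟧ * (t * x₃ + α * y₃ + (t * x₃ + α * y₃))
      + ⟦ i ⟧ * (t * x₄ + α * x₀)
      + ⟦ j ⟧ * (t * x₅ + α * y₅)
      + ⟦ k ⟧ * (t * x₆ + α * y₆)
        -- The isolated term α x₀ is the derivative of the additional factor S; on the other side it
        -- is that of the additional factor w, and raises the coefficient i to 1 + i.
        ≈⟨ solve 19 (λ t α a b i j k x₀ x₁ x₂ x₃ x₄ x₅ x₆ y₁ y₂ y₃ y₅ y₆ →
             t :* x₁ :+ α :* y₁
             :+ (α :* x₀ :+ a :* (α :* (t :* x₂ :+ α :* y₂)))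
             :+ b :* (t :* x₃ :+ α :* y₃ :+ (t :* x₃ :+ α :* y₃))
             :+ i :* (t :* x₄ :+ α :* x₀)
             :+ j :* (t :* x₅ :+ α :* y₅)
             :+ k :* (t :* x₆ :+ α :* y₆)
             := t :* (x₁ :+ a :* (α :* x₂) :+ b :* (x₃ :+ x₃) :+ i :* x₄ :+ j :* x₅ :+ k :* x₆)
             :+ α :* (y₁ :+ a :* (α :* y₂) :+ b :* (y₃ :+ y₃) :+ (con 1 :+ i) :* x₀ :+ j :* y₅ :+ k :* y₆))
             refl t α ⟦ a ⟧ ⟦ b ⟧ ⟦ i ⟧ ⟦ j ⟧ ⟦ k ⟧ x₀ x₁ x₂ x₃ x₄ x₅ x₆ y₁ y₂ y₃ y₅ y₆ ⟩
      _ ∎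
      where
      x₀ = I n a b i j (suc k)
      x₁ = I n (suc a) b i j k
      x₂ = I n (pred a) b i j (suc k)
      x₃ = I n a (pred b) i j (suc k)
      x₄ = I n a b (pred i) j (suc k)
      x₅ = I n a b i (pred j) (suc k)
      x₆ = I n a (suc b) i j k
      y₁ = I n (suc a) b (suc i) j k
      y₂ = I n (pred a) b (suc i) j (suc k)
      y₃ = I n a (pred b) (suc i) j (suc k)
      y₅ = I n a b (suc i) (pred j) (suc k)
      y₆ = I n a (suc b) (suc i) j k

    -- The same argument for s = w + v: both sides have the derivative 2 p.
    iter-s : ∀ n a b i j k → I n a (suc b) i j k ≈ I n a b (suc i) j k + I n a b i (suc j) k
    iter-s zero a b i j k = begin
      S ^ a * (s * s ^ b) * w ^ i * v ^ j * p ^ k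
        ≈⟨ *-congʳ (*-congʳ (*-congʳ (*-congˡ (*-congʳ s≈)))) ⟩
      S ^ a * ((w + v) * s ^ b) * w ^ i * v ^ j * p ^ k
        ≈⟨ solve 7 (λ w v Sᵃ sᵇ wⁱ vʲ pᵏ →
             Sᵃ :* ((w :+ v) :* sᵇ) :* wⁱ :* vʲ :* pᵏ :=
             Sᵃ :* sᵇ :* (w :* wⁱ) :* vʲ :* pᵏ :+ Sᵃ :* sᵇ :* wⁱ :* (v :* vʲ) :* pᵏ)
             refl w v (S ^ a) (s ^ b) (w ^ i) (v ^ j) (p ^ k) ⟩
      _ ∎
    iter-s (suc n) a b i j k = begin
      I n (suc a) (suc b) i j k
      + ⟦ a ⟧ * (α * I n (pred a) (suc b) i j (suc k))
      + (1# + ⟦ b ⟧) * (I n a b i j (suc k) + I n a b i j (suc k))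
      + ⟦ i ⟧ * I n a (suc b) (pred i) j (suc k)
      + ⟦ j ⟧ * I n a (suc b) i (pred j) (suc k)
      + ⟦ k ⟧ * I n a (suc (suc b)) i j k
        ≈⟨ +-cong (+-cong (+-cong (+-cong (+-cong
             (iter-s n (suc a) b i j k)
             (*-congˡ (*-congˡ (iter-s n (pred a) b i j (suc k)))))
             (trans (distribʳ _ _ _) (+-cong (*-identityˡ _)
               (pred-cong b {λ b → I n a b i j (suc k) + I n a b i j (suc k)} λ { b′ ≡.refl →
                 +-cong (iter-s n a b′ i j (suc k)) (iter-s n a b′ i j (suc k)) }))))
             (pred-cong i {λ i → I n a (suc b) (pred i) j (suc k)}
               λ { i′ ≡.refl → iter-s n a b i′ j (suc k) }))
             (pred-cong j {λ j → I n a (suc b) i (pred j) (suc k)}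
               λ { j′ ≡.refl → iter-s n a b i j′ (suc k) }))
             (*-congˡ (iter-s n a (suc b) i j k)) ⟩
      x₁ + y₁
      + ⟦ a ⟧ * (α * (x₂ + y₂))
      + (x₀ + x₀ + ⟦ b ⟧ * (x₃ + y₃ + (x₃ + y₃)))
      + ⟦ i ⟧ * (x₀ + y₄)
      + ⟦ j ⟧ * (x₅ + x₀)
      + ⟦ k ⟧ * (x₆ + y₆)
        -- Of the two isolated copies of x₀, one becomes ∂w in the first summand and the other ∂v in
        -- the second.
        ≈⟨ solve 17 (λ α a b i j k x₀ x₁ x₂ x₃ x₅ x₆ y₁ y₂ y₃ y₄ y₆ →
             x₁ :+ y₁
             :+ a :* (α :* (x₂ :+ y₂))
             :+ (x₀ :+ x₀ :+ b :* (x₃ :+ y₃ :+ (x₃ :+ y₃)))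
             :+ i :* (x₀ :+ y₄)
             :+ j :* (x₅ :+ x₀)
             :+ k :* (x₆ :+ y₆)
             := (x₁ :+ a :* (α :* x₂) :+ b :* (x₃ :+ x₃) :+ (con 1 :+ i) :* x₀ :+ j :* x₅ :+ k :* x₆)
             :+ (y₁ :+ a :* (α :* y₂) :+ b :* (y₃ :+ y₃) :+ i :* y₄ :+ (con 1 :+ j) :* x₀ :+ k :* y₆))
             refl α ⟦ a ⟧ ⟦ b ⟧ ⟦ i ⟧ ⟦ j ⟧ ⟦ k ⟧ x₀ x₁ x₂ x₃ x₅ x₆ y₁ y₂ y₃ y₄ y₆ ⟩
      _ ∎
      where
      x₀ = I n a b i j (suc k)
      x₁ = I n (suc a) b (suc i) j k
      x₂ = I n (pred a) b (suc i) j (suc k)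
      x₃ = I n a (pred b) (suc i) j (suc k)
      x₅ = I n a b (suc i) (pred j) (suc k)
      x₆ = I n a (suc b) (suc i) j k
      y₁ = I n (suc a) b i (suc j) k
      y₂ = I n (pred a) b i (suc j) (suc k)
      y₃ = I n a (pred b) i (suc j) (suc k)
      y₄ = I n a b (pred i) (suc j) (suc k)
      y₆ = I n a (suc b) i (suc j) k

-- Step profiles of words

<ᵇ-true : ∀ {a b} → a ℕ.< b → (a <ᵇ b) ≡ true
<ᵇ-true {a} {b} a<b with a <ᵇ b | ℕ.<⇒<ᵇ a<b
... | true | _ = ≡.refl

<ᵇ-false : ∀ {a b} → b ℕ.≤ a → (a <ᵇ b) ≡ false
<ᵇ-false {a} {b} b≤a with a <ᵇ b in eq
... | false = ≡.refl
... | true  = contradiction (ℕ.<ᵇ⇒< a b (≡.subst T (≡.sym eq) _)) (ℕ.≤⇒≯ b≤a)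

record Profile : Set where
  constructor profile
  field
    rises falls peaks rlmins : ℕ

open Profile

bit : Bool → ℕ
bit b = if b then 1 else 0

addRise addFall addPeak : Profile → Profile
addRise P = record P { rises = suc (rises P) }
addFall P = record P { falls = suc (falls P) }
addPeak P = record P { peaks = suc (peaks P) }

-- The bit is the right summand so that this map commutes definitionally with taking the successor
-- of `rlmins`, as it occurs in `children`.
addRLmin : Bool → Profile → Profile
addRLmin b P = record P { rlmins = rlmins P ℕ.+ bit b }

addRLmin-false : ∀ P → addRLmin false P ≡ P
addRLmin-false (profile i j k r) = ≡.cong (profile i j k) (ℕ.+-identityʳ r)

isMin : ∀ {n} → ℕ → Vec ℕ n → Bool
isMin a []       = true
isMin a (x ∷ xs) = (a <ᵇ x) ∧ isMin a xs

ascend descend : Bool → Profile → Profile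
ascend  up = if up then addRise else id
descend up = if up then addPeak else addFall

-- An ascent and a descent that meet at a peak are tallied together under
-- `peaks`, all other steps under `rises` and `falls`.  The flag says that the
-- letter a was reached by an ascent, which is then still untallied.
walk : ∀ {n} → Bool → ℕ → Vec ℕ n → Profile
walk up a []       = profile (bit up) 0 0 0
walk up a (b ∷ xs) = addRLmin (isMin b xs)
  (if a <ᵇ b then ascend up (walk true b xs) else descend up (walk false b xs))

-- A larger letter further right never stops a from being a right-to-left minimum.
isMin-insertAt : ∀ {n a N} (xs : Vec ℕ n) i → a ℕ.< N → isMin a (insertAt xs i N) ≡ isMin a xs
isMin-insertAt {a = a} {N} xs       zero    a<N rewrite <ᵇ-true a<N = ≡.refl
isMin-insertAt {a = a}     (x ∷ xs) (suc i) a<N =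
  ≡.cong ((a <ᵇ x) ∧_) (isMin-insertAt xs i a<N)

-- The steps from a to N and from N to b meet at the peak N. The pending ascent into a is followed
-- by an ascent, so it is a rise, and b on its right keeps N from being a right-to-left minimum.
walk-max : ∀ {n} up {a b N} (xs : Vec ℕ n) → a ℕ.< N → b ℕ.< N →
           walk up a (N ∷ b ∷ xs) ≡ ascend up (addRLmin (isMin b xs) (addPeak (walk false b xs)))
walk-max true  {N = N} xs a<N b<N rewrite <ᵇ-true a<N | <ᵇ-false (ℕ.<⇒≤ b<N) =
  addRLmin-false _
walk-max false {N = N} xs a<N b<N rewrite <ᵇ-true a<N | <ᵇ-false (ℕ.<⇒≤ b<N) =
  addRLmin-false _

-- Sums over the insertions of a new largest letter

module Insertion {c ℓ} (R : CommutativeRing c ℓ) where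

  open RingNotation R hiding (zero)
  open Derivation R
  open import Algebra.Solver.Ring.NaturalCoefficients.Default commutativeSemiring
    using (solve; _:=_; _:+_; _:*_; con)
  open import Relation.Binary.Reasoning.Setoid setoid

  -- Recursion on the word instead of the position, to match the recursions of `walk` and `weight`.
  ∑-insertions : ∀ {a} {A : Set a} {n} → (Vec A (suc n) → Carrier) → A → Vec A n → Carrier
  ∑-insertions f x []       = f (x ∷ [])
  ∑-insertions f x (y ∷ ys) = f (x ∷ y ∷ ys) + ∑-insertions (f ∘ (y ∷_)) x ys

  module _ {a} {A : Set a} where

    ∑-insertAt : ∀ {n} (f : Vec A (suc n) → Carrier) x (ys : Vec A n) →
                 (∑[ i ∈ List.allFin (suc n) ] f (insertAt ys i x)) ≈ ∑-insertions f x ys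
    ∑-insertAt f x []       = +-identityʳ _
    ∑-insertAt f x (y ∷ ys) = +-congˡ (trans
      (reflexive (≡.trans (≡.cong (λ is → ∑ is g) (≡.sym (map-tabulate id suc))) (foldr-map (λ i s → g i + s) suc 0# (List.allFin _))))
      (∑-insertAt (f ∘ (y ∷_)) x ys))
      where
      g : Fin _ → Carrier
      g i = f (insertAt (y ∷ ys) i x)

    ∑-insertions-cong : ∀ {n f g x} (ys : Vec A n) →
                        (∀ i → f (insertAt ys i x) ≈ g (insertAt ys i x)) →
                        ∑-insertions f x ys ≈ ∑-insertions g x ys
    ∑-insertions-cong []       eq = eq zero
    ∑-insertions-cong (y ∷ ys) eq = +-cong (eq zero) (∑-insertions-cong ys (eq ∘ suc))

    ∑-insertions-* : ∀ {n f} t x (ys : Vec A n) →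
                     ∑-insertions (λ zs → t * f zs) x ys ≈ t * ∑-insertions f x ys
    ∑-insertions-* t x []       = refl
    ∑-insertions-* t x (y ∷ ys) = trans (+-congˡ (∑-insertions-* t x ys)) (sym (distribˡ t _ _))

    ∑-insertions-0 : ∀ {n} x (ys : Vec A n) → ∑-insertions (λ _ → 0#) x ys ≈ 0#
    ∑-insertions-0 x []       = refl
    ∑-insertions-0 x (y ∷ ys) = trans (+-identityˡ _) (∑-insertions-0 x ys)

  -- The insertions after the letter 1: at the end, which creates a rise and a right-to-left
  -- minimum; into a rise; into a fall; and into the two gaps beside a peak, where the old step
  -- outside the new peak is left as a rise or a fall.
  children : (Profile → Carrier) → Profile → Carrier
  children φ (profile i j k r) =
      φ (profile (suc i) j k (suc r))
    + ⟦ i ⟧ * φ (profile (pred i) j (suc k) r)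
    + ⟦ j ⟧ * φ (profile i (pred j) (suc k) r)
    + ⟦ k ⟧ * (φ (profile (suc i) j k r) + φ (profile i (suc j) k r))

  module _ (φ : Profile → Carrier) where

    -- Product rule for one more rise: an insertion either leaves it alone or turns it into a peak.
    -- The next two lemmas are the analogues for a fall and a peak.
    children-addRise : ∀ P → children (φ ∘ addRise) P + φ (addPeak P) ≈ children φ (addRise P)
    children-addRise (profile i j k r) = begin
      x₁ + ⟦ i ⟧ * φ (profile (suc (pred i)) j (suc k) r) + ⟦ j ⟧ * x₃ + ⟦ k ⟧ * x₄ + x₂
        -- At i = 0, `suc (pred i)` differs from i, but the coefficient is zero.
        ≈⟨ +-congʳ (+-congʳ (+-congʳ (+-congˡ (pred-cong i
             {λ i → φ (profile (suc (pred i)) j (suc k) r)} λ { i ≡.refl → refl })))) ⟩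
      x₁ + ⟦ i ⟧ * x₂ + ⟦ j ⟧ * x₃ + ⟦ k ⟧ * x₄ + x₂
        ≈⟨ solve 7 (λ i j k x₁ x₂ x₃ x₄ →
             x₁ :+ i :* x₂ :+ j :* x₃ :+ k :* x₄ :+ x₂ :=
             x₁ :+ (con 1 :+ i) :* x₂ :+ j :* x₃ :+ k :* x₄)
             refl ⟦ i ⟧ ⟦ j ⟧ ⟦ k ⟧ x₁ x₂ x₃ x₄ ⟩
      _ ∎
      where
      x₁ = φ (profile (suc (suc i)) j k (suc r))
      x₂ = φ (profile i j (suc k) r)
      x₃ = φ (profile (suc i) (pred j) (suc k) r)
      x₄ = φ (profile (suc (suc i)) j k r) + φ (profile (suc i) (suc j) k r)

    children-addFall : ∀ P → children (φ ∘ addFall) P + φ (addPeak P) ≈ children φ (addFall P)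
    children-addFall (profile i j k r) = begin
      x₁ + ⟦ i ⟧ * x₂ + ⟦ j ⟧ * φ (profile i (suc (pred j)) (suc k) r) + ⟦ k ⟧ * x₄ + x₃
        ≈⟨ +-congʳ (+-congʳ (+-congˡ (pred-cong j
             {λ j → φ (profile i (suc (pred j)) (suc k) r)} λ { j ≡.refl → refl }))) ⟩
      x₁ + ⟦ i ⟧ * x₂ + ⟦ j ⟧ * x₃ + ⟦ k ⟧ * x₄ + x₃
        ≈⟨ solve 7 (λ i j k x₁ x₂ x₃ x₄ →
             x₁ :+ i :* x₂ :+ j :* x₃ :+ k :* x₄ :+ x₃ :=
             x₁ :+ i :* x₂ :+ (con 1 :+ j) :* x₃ :+ k :* x₄)
             refl ⟦ i ⟧ ⟦ j ⟧ ⟦ k ⟧ x₁ x₂ x₃ x₄ ⟩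
      _ ∎
      where
      x₁ = φ (profile (suc i) (suc j) k (suc r))
      x₂ = φ (profile (pred i) (suc j) (suc k) r)
      x₃ = φ (profile i j (suc k) r)
      x₄ = φ (profile (suc i) (suc j) k r) + φ (profile i (suc (suc j)) k r)

    children-addPeak : ∀ P → children (φ ∘ addPeak) P + (φ (addRise (addPeak P)) + φ (addFall (addPeak P)))
                           ≈ children φ (addPeak P)
    children-addPeak (profile i j k r) =
      solve 7 (λ i j k x₁ x₂ x₃ x₄ →
        x₁ :+ i :* x₂ :+ j :* x₃ :+ k :* x₄ :+ x₄ :=
        x₁ :+ i :* x₂ :+ j :* x₃ :+ (con 1 :+ k) :* x₄)
        refl ⟦ i ⟧ ⟦ j ⟧ ⟦ k ⟧ _ _ _ _

  -- With up = true, the gap before a is left out of the sum; the additional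
  -- term on the left accounts for it.
  ∑-walk  : ∀ {n} φ {a N} (xs : Vec ℕ n) → a ℕ.< N → All (ℕ._< N) xs →
            ∑-insertions (φ ∘ walk false a) N xs ≈ children φ (walk false a xs)
  ∑-walk↑ : ∀ {n} φ {a N} (xs : Vec ℕ n) → a ℕ.< N → All (ℕ._< N) xs →
            ∑-insertions (φ ∘ walk true a) N xs + φ (addPeak (walk false a xs))
              ≈ children φ (walk true a xs)

  ∑-walk φ {a} {N} [] a<N [] rewrite <ᵇ-true a<N =
    solve 4 (λ x₁ x₂ x₃ x₄ → x₁ := x₁ :+ con 0 :* x₂ :+ con 0 :* x₃ :+ con 0 :* x₄) refl _ _ _ _
  ∑-walk φ {a} {N} (b ∷ xs) a<N (b<N ∷ xs<N) = begin
    φ (walk false a (N ∷ b ∷ xs)) + ∑-insertions (λ ys → φ (walk false a (b ∷ ys))) N xs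
      -- An insertion behind b does not affect whether b is a right-to-left minimum, so this bit is
      -- absorbed into ψ.
      ≈⟨ +-cong (reflexive (≡.cong φ (walk-max false xs a<N b<N)))
           (∑-insertions-cong xs λ i → reflexive (≡.cong (λ m → step m (insertAt xs i N)) (isMin-insertAt xs i b<N))) ⟩
    ψ (addPeak w) + ∑-insertions (λ ys → ψ (if a <ᵇ b then walk true b ys else addFall (walk false b ys))) N xs
      ≈⟨ lemma (a <ᵇ b) ⟩
    _ ∎
    where
    step : Bool → Vec ℕ _ → Carrier
    step m ys = φ (addRLmin m (if a <ᵇ b then walk true b ys else addFall (walk false b ys)))
    ψ = φ ∘ addRLmin (isMin b xs)
    w = walk false b xs
    lemma : ∀ a<ᵇb → ψ (addPeak w) + ∑-insertions (λ ys → ψ (if a<ᵇb then walk true b ys else addFall (walk false b ys))) N xs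
             ≈ children φ (addRLmin (isMin b xs) (if a<ᵇb then walk true b xs else addFall w))
    -- The insertion between a and b is exactly the gap that `∑-walk↑` leaves out.
    lemma true  = trans (+-comm _ _) (∑-walk↑ ψ xs b<N xs<N)
    lemma false = trans (+-comm _ _) (trans (+-congʳ (∑-walk (ψ ∘ addFall) xs b<N xs<N)) (children-addFall ψ w))

  -- The profile consists of one rise, the ascent into a; the additional term is the insertion into
  -- it.
  ∑-walk↑ φ {a} {N} [] a<N [] rewrite <ᵇ-true a<N =
    solve 4 (λ x₁ x₂ x₃ x₄ → x₁ :+ x₂ := x₁ :+ (con 1 :+ con 0) :* x₂ :+ con 0 :* x₃ :+ con 0 :* x₄) refl _ _ _ _
  ∑-walk↑ φ {a} {N} (b ∷ xs) a<N (b<N ∷ xs<N) = begin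
    φ (walk true a (N ∷ b ∷ xs)) + ∑-insertions (λ ys → φ (walk true a (b ∷ ys))) N xs
      + φ (addPeak (walk false a (b ∷ xs)))
      ≈⟨ +-congʳ (+-cong (reflexive (≡.cong φ (walk-max true xs a<N b<N)))
           (∑-insertions-cong xs λ i → reflexive (≡.cong (λ m → step m (insertAt xs i N)) (isMin-insertAt xs i b<N)))) ⟩
    ψ (addRise (addPeak w))
      + ∑-insertions (λ ys → ψ (if a <ᵇ b then addRise (walk true b ys) else addPeak (walk false b ys))) N xs
      + ψ (addPeak (if a <ᵇ b then walk true b xs else addFall w))
      ≈⟨ lemma (a <ᵇ b) ⟩
    _ ∎
    where
    step : Bool → Vec ℕ _ → Carrier
    step m ys = φ (addRLmin m (if a <ᵇ b then addRise (walk true b ys) else addPeak (walk false b ys)))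
    ψ = φ ∘ addRLmin (isMin b xs)
    w = walk false b xs
    lemma : ∀ a<ᵇb →
      ψ (addRise (addPeak w))
      + ∑-insertions (λ ys → ψ (if a<ᵇb then addRise (walk true b ys) else addPeak (walk false b ys))) N xs
      + ψ (addPeak (if a<ᵇb then walk true b xs else addFall w))
      ≈ children φ (addRLmin (isMin b xs) (if a<ᵇb then addRise (walk true b xs) else addPeak w))
    -- Now the ascent into a is a rise, and the additional term is the insertion into it.
    lemma true  = trans (+-congʳ (trans (+-comm _ _) (∑-walk↑ (ψ ∘ addRise) xs b<N xs<N)))
                        (children-addRise ψ (walk true b xs))
    -- Now a is a peak; the front insertion and the additional term are those into its two gaps.
    lemma false = trans (+-congʳ (trans (+-comm _ _) (+-congʳ (∑-walk (ψ ∘ addPeak) xs b<N xs<N))))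
                    (trans (+-assoc _ _ _) (children-addPeak ψ w))

  -- A word that is not of the form D 1 R with D decreasing has weight 0; the
  -- letters of D contribute a factor t each.
  weight : ∀ {n} → Carrier → (Profile → Carrier) → Vec ℕ n → Carrier
  weight t φ []               = 0#
  weight t φ (zero ∷ xs)      = φ (walk false 0 xs)
  weight t φ (suc a ∷ [])     = 0#
  weight t φ (suc a ∷ b ∷ xs) = if b <ᵇ suc a then t * weight t φ (b ∷ xs) else 0#

  -- In front the new letter lengthens D and contributes t; between two letters of D 1 it creates an
  -- ascent at a letter other than 1; after 1 `∑-walk` applies.
  ∑-weight : ∀ {n} t φ {N} (xs : Vec ℕ (suc n)) → All (ℕ._< N) xs →
             ∑-insertions (weight t φ) N xs ≈ weight t (λ P → t * φ P + children φ P) xs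
  ∑-weight t φ {suc N} (zero ∷ xs) (_ ∷ xs<N) = +-congˡ (∑-walk φ xs z<s xs<N)
  ∑-weight t φ {suc N} (suc a ∷ []) (a<N ∷ []) rewrite <ᵇ-true a<N | <ᵇ-false (ℕ.<⇒≤ a<N) =
    trans (+-congʳ (zeroʳ t)) (+-identityʳ _)
  ∑-weight t φ {suc N} (suc a ∷ b ∷ xs) (a<N ∷ b<N ∷ xs<N)
    rewrite <ᵇ-true a<N | <ᵇ-false (ℕ.<⇒≤ a<N) = lemma (b <ᵇ suc a)
    where
    lemma : ∀ b<ᵇa →
      t * (if b<ᵇa then t * weight t φ (b ∷ xs) else 0#)
      + (0# + ∑-insertions (λ ys → if b<ᵇa then t * weight t φ (b ∷ ys) else 0#) (suc N) xs)
      ≈ (if b<ᵇa then t * weight t (λ P → t * φ P + children φ P) (b ∷ xs) else 0#)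
    lemma false = trans (+-cong (zeroʳ t) (trans (+-identityˡ _) (∑-insertions-0 (suc N) xs))) (+-identityʳ _)
    lemma true  = begin
      t * (t * weight t φ (b ∷ xs)) + (0# + ∑-insertions (λ ys → t * weight t φ (b ∷ ys)) (suc N) xs)
        ≈⟨ +-congˡ (trans (+-identityˡ _) (∑-insertions-* t (suc N) xs)) ⟩
      t * (t * weight t φ (b ∷ xs)) + t * ∑-insertions (λ ys → weight t φ (b ∷ ys)) (suc N) xs
        ≈⟨ distribˡ t _ _ ⟨
      t * (t * weight t φ (b ∷ xs) + ∑-insertions (λ ys → weight t φ (b ∷ ys)) (suc N) xs)
        -- N in front of `suc a` has the weight of t times N in front of b, and so fills the place
        -- of the vanishing insertion between the two letters.
        ≈⟨ *-congˡ (+-congʳ (reflexive (≡.cong (λ c → if c then t * weight t φ (b ∷ xs) else 0#) (≡.sym (<ᵇ-true b<N))))) ⟩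
      t * ∑-insertions (weight t φ) (suc N) (b ∷ xs)
        ≈⟨ *-congˡ (∑-weight t φ (b ∷ xs) (b<N ∷ xs<N)) ⟩
      t * weight t (λ P → t * φ P + children φ P) (b ∷ xs) ∎

-- Weight sums over all permutations

module PermutationSums {c ℓ} (R : CommutativeRing c ℓ) where

  open RingNotation R hiding (zero)
  open Derivation R
  open Insertion R
  open import Algebra.Solver.Ring.NaturalCoefficients.Default commutativeSemiring
    using (solve; _:=_; _:+_; _:*_; con)
  open import Relation.Binary.Reasoning.Setoid setoid

  module _ {a} {A : Set a} where

    ∑-cong : ∀ (xs : List A) {f g : A → Carrier} → (∀ x → x ∈ xs → f x ≈ g x) → ∑ xs f ≈ ∑ xs g
    ∑-cong []       _  = refl
    ∑-cong (x ∷ xs) eq = +-cong (eq x (Any.here ≡.refl)) (∑-cong xs (λ y → eq y ∘ Any.there))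

    ∑-↭ : ∀ {xs ys : List A} (f : A → Carrier) → xs ↭ ys → ∑ xs f ≈ ∑ ys f
    ∑-↭ f ↭.refl         = refl
    ∑-↭ f (↭.prep x p)   = +-congˡ (∑-↭ f p)
    ∑-↭ f (↭.swap x y p) = trans (sym (+-assoc _ _ _)) (trans (+-cong (+-comm _ _) (∑-↭ f p)) (+-assoc _ _ _))
    ∑-↭ f (↭.trans p q)  = trans (∑-↭ f p) (∑-↭ f q)

    ∑-++ : ∀ xs ys (f : A → Carrier) → ∑ (xs ++ ys) f ≈ ∑ xs f + ∑ ys f
    ∑-++ []       ys f = sym (+-identityˡ _)
    ∑-++ (x ∷ xs) ys f = trans (+-congˡ (∑-++ xs ys f)) (sym (+-assoc _ _ _))

    ∑-map : ∀ {b} {B : Set b} (h : B → A) xs (f : A → Carrier) → ∑ (List.map h xs) f ≈ ∑ xs (f ∘ h)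
    ∑-map h []       f = refl
    ∑-map h (x ∷ xs) f = +-congˡ (∑-map h xs f)

    ∑-filter : ∀ {p} {P : Pred A p} (P? : Decidable P) xs (f : A → Carrier) →
               ∑ (filter P? xs) f ≈ ∑ xs (λ x → if does (P? x) then f x else 0#)
    ∑-filter P? []       f = refl
    ∑-filter P? (x ∷ xs) f with does (P? x)
    ... | true  = +-congˡ (∑-filter P? xs f)
    ... | false = trans (∑-filter P? xs f) (sym (+-identityˡ _))

  ∑-cartesianProductWith : ∀ {a b c} {A : Set a} {B : Set b} {C : Set c} (h : A → B → C) xs ys f →
    ∑ (cartesianProductWith h xs ys) f ≈ (∑[ x ∈ xs ] ∑[ y ∈ ys ] f (h x y))
  ∑-cartesianProductWith h []       ys f = refl
  ∑-cartesianProductWith h (x ∷ xs) ys f =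
    trans (∑-++ (List.map (h x) ys) _ f) (+-cong (∑-map (h x) ys f) (∑-cartesianProductWith h xs ys f))

  weight-cong : ∀ {n t φ ψ} → (∀ P → φ P ≈ ψ P) → ∀ (xs : Vec ℕ n) → weight t φ xs ≈ weight t ψ xs
  weight-cong eq []               = refl
  weight-cong eq (zero ∷ xs)      = eq _
  weight-cong eq (suc a ∷ [])     = refl
  weight-cong eq (suc a ∷ b ∷ xs) with b <ᵇ suc a | weight-cong eq (b ∷ xs)
  ... | true  | ih = *-congˡ ih
  ... | false | _  = refl

  toℕ<n : ∀ {n k} (xs : Vec (Fin n) k) → All (ℕ._< n) (Vec.map toℕ xs)
  toℕ<n []       = []
  toℕ<n (x ∷ xs) = Fin.toℕ<n x ∷ toℕ<n xs

  map-toℕ-insertMax : ∀ {n} (σ : Word n) i → Vec.map toℕ (insertMax σ i) ≡ insertAt (Vec.map toℕ σ) i n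
  map-toℕ-insertMax {n} σ i = ≡.trans (Vec.map-insertAt toℕ _ _ i)
    (≡.cong₂ (λ xs → insertAt xs i)
      (≡.trans (≡.sym (Vec.map-∘ toℕ inject₁ σ)) (Vec.map-cong Fin.toℕ-inject₁ σ))
      (Fin.toℕ-fromℕ n))

  module _ (α v w p : Carrier) where

    private I = iter α (α * v + α * w) (w + v) w v p

    -- The total weight after n further insertions, up to the factor from D: (S + ∂)ⁿ applied to the
    -- monomial of the profile.
    profileWeight : ℕ → Profile → Carrier
    profileWeight n (profile i j k r) = α ^ r * I n 0 0 i j k

    -- Insertion acts as S + ∂: the front and end insertions combine to S by `iter-S`, and the two
    -- gaps beside a peak to p (w + v) by `iter-s`.
    profileWeight-suc : ∀ n P → α * v * profileWeight n P + children (profileWeight n) P ≈ profileWeight (suc n) P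
    profileWeight-suc n (profile i j k r) = begin
      α * v * (A * x₀) + (α * A * x₁ + ⟦ i ⟧ * (A * x₂) + ⟦ j ⟧ * (A * x₃) + ⟦ k ⟧ * (A * x₁ + A * x₄))
        -- The two zeros hold the places of the terms of ∂S and ∂s, whose exponents are 0.
        ≈⟨ solve 11 (λ α v A x₀ x₁ x₂ x₃ x₄ i j k →
             α :* v :* (A :* x₀) :+ (α :* A :* x₁ :+ i :* (A :* x₂) :+ j :* (A :* x₃) :+ k :* (A :* x₁ :+ A :* x₄)) :=
             A :* (α :* v :* x₀ :+ α :* x₁ :+ con 0 :+ con 0 :+ i :* x₂ :+ j :* x₃ :+ k :* (x₁ :+ x₄)))
             refl α v A x₀ x₁ x₂ x₃ x₄ ⟦ i ⟧ ⟦ j ⟧ ⟦ k ⟧ ⟩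
      A * (α * v * x₀ + α * x₁ + 0# + 0# + ⟦ i ⟧ * x₂ + ⟦ j ⟧ * x₃ + ⟦ k ⟧ * (x₁ + x₄))
        ≈⟨ *-congˡ (+-cong (+-congʳ (+-congʳ (+-cong (+-cong
             (sym (iter-S {t = α * v} refl refl n 0 0 i j k))
             (sym (zeroˡ _))) (sym (zeroˡ _)))))
             (*-congˡ (sym (iter-s {t = α * v} refl refl n 0 0 i j k)))) ⟩
      A * I (suc n) 0 0 i j k ∎
      where
      A = α ^ r
      x₀ = I n 0 0 i j k
      x₁ = I n 0 0 (suc i) j k
      x₂ = I n 0 0 (ℕ.pred i) j (suc k)
      x₃ = I n 0 0 i (ℕ.pred j) (suc k)
      x₄ = I n 0 0 i (suc j) k

    -- Here m counts the insertions already moved into the weight; each step of the induction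
    -- removes the largest letter and raises m.
    ∑-permutations : ∀ n m →
      (∑[ σ ∈ 𝔖 (suc n) ] weight (α * v) (profileWeight m) (Vec.map toℕ σ)) ≈ I (n ℕ.+ m) 0 0 0 0 0
    -- Only the one-letter word is left, and its profile is empty.
    ∑-permutations zero    m = trans (+-identityʳ _) (*-identityˡ _)
    ∑-permutations (suc n) m = begin
      ∑ (𝔖 (suc (suc n))) f
        ≈⟨ ∑-↭ f (𝔖-suc (suc n)) ⟩
      ∑ (cartesianProductWith insertMax (𝔖 (suc n)) (List.allFin (suc (suc n)))) f
        ≈⟨ ∑-cartesianProductWith insertMax (𝔖 (suc n)) _ f ⟩
      (∑[ σ ∈ 𝔖 (suc n) ] ∑[ i ∈ List.allFin (suc (suc n)) ] f (insertMax σ i))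
        ≈⟨ ∑-cong (𝔖 (suc n)) (λ σ _ → begin
             (∑[ i ∈ List.allFin (suc (suc n)) ] f (insertMax σ i))
               ≈⟨ ∑-cong (List.allFin (suc (suc n))) (λ i _ → reflexive (≡.cong (weight (α * v) (profileWeight m)) (map-toℕ-insertMax σ i))) ⟩
             (∑[ i ∈ List.allFin (suc (suc n)) ] weight (α * v) (profileWeight m) (insertAt (Vec.map toℕ σ) i (suc n)))
               ≈⟨ ∑-insertAt (weight (α * v) (profileWeight m)) (suc n) (Vec.map toℕ σ) ⟩
             ∑-insertions (weight (α * v) (profileWeight m)) (suc n) (Vec.map toℕ σ)
               ≈⟨ ∑-weight (α * v) (profileWeight m) (Vec.map toℕ σ) (toℕ<n σ) ⟩
             weight (α * v) (λ P → α * v * profileWeight m P + children (profileWeight m) P) (Vec.map toℕ σ)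
               ≈⟨ weight-cong (profileWeight-suc m) (Vec.map toℕ σ) ⟩
             weight (α * v) (profileWeight (suc m)) (Vec.map toℕ σ) ∎) ⟩
      (∑[ σ ∈ 𝔖 (suc n) ] weight (α * v) (profileWeight (suc m)) (Vec.map toℕ σ))
        ≈⟨ ∑-permutations n (suc m) ⟩
      I (n ℕ.+ suc m) 0 0 0 0 0
        ≡⟨ ≡.cong (λ l → I l 0 0 0 0 0) (ℕ.+-suc n m) ⟩
      I (suc n ℕ.+ m) 0 0 0 0 0 ∎
      where
      f : Word (suc (suc n)) → Carrier
      f σ = weight (α * v) (profileWeight m) (Vec.map toℕ σ)

-- Recursions for the permutation statistics

tally : ∀ {n} → (Fin n → Bool) → ℕ
tally {zero}  f = 0
tally {suc n} f = bit (f zero) ℕ.+ tally (f ∘ suc)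

tally-cong : ∀ {n} {f g : Fin n → Bool} → (∀ i → f i ≡ g i) → tally f ≡ tally g
tally-cong {zero}  eq = ≡.refl
tally-cong {suc n} eq = ≡.cong₂ ℕ._+_ (≡.cong bit (eq zero)) (tally-cong (eq ∘ suc))

tally-false : ∀ {n} {f : Fin n → Bool} → (∀ i → f i ≡ false) → tally f ≡ 0
tally-false {zero}  eq = ≡.refl
tally-false {suc n} eq rewrite eq zero = tally-false (eq ∘ suc)

count-tabulate : ∀ {m n} {P : Pred (Fin n) 0ℓ} (P? : Decidable P) (g : Fin m → Fin n) →
                 Vec.count P? (Vec.tabulate g) ≡ tally (does ∘ P? ∘ g)
count-tabulate {zero}  P? g = ≡.refl
count-tabulate {suc m} P? g with does (P? (g zero))
... | true  = ≡.cong suc (count-tabulate P? (g ∘ suc))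
... | false = count-tabulate P? (g ∘ suc)

#-tally : ∀ {n} {P : Pred (Fin n) 0ℓ} (P? : Decidable P) → #[ P? ] ≡ tally (does ∘ P?)
#-tally P? = count-tabulate P? id

-- The statistics of Defs, for words whose length is not tied to the alphabet.
module _ {k : ℕ} where

  ascents descents : ∀ {m} → Vec (Fin k) (suc m) → ℕ
  ascents  xs = tally λ i → toℕ (lookup xs (inject₁ i)) <ᵇ toℕ (lookup xs (suc i))
  descents xs = tally λ i → toℕ (lookup xs (suc i)) <ᵇ toℕ (lookup xs (inject₁ i))

  lrMin? : ∀ {n} (xs : Vec (Fin k) n) i → Dec (∀ j → j < i → lookup xs j > lookup xs i)
  lrMin? xs i = Fin.all? (λ j → (j Fin.<? i) →-dec (lookup xs i Fin.<? lookup xs j))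

  rlMin? : ∀ {n} (xs : Vec (Fin k) n) i → Dec (∀ j → j > i → lookup xs j > lookup xs i)
  rlMin? xs i = Fin.all? (λ j → (i Fin.<? j) →-dec (lookup xs i Fin.<? lookup xs j))

  lrMins rlMins : ∀ {n} → Vec (Fin k) n → ℕ
  lrMins xs = tally (does ∘ lrMin? xs)
  rlMins xs = tally (does ∘ rlMin? xs)

  _<⁺ᵇ_ : Fin k ⁺ → Fin k ⁺ → Bool
  x <⁺ᵇ y = does (<⁺-dec _<_ Fin._<?_ x y)

  pad : ∀ {n} → Vec (Fin k) n → Vec (Fin k ⁺) (suc n)
  pad xs = Vec.map [_] xs ∷ʳ ⊤⁺

  -- The left neighbour l is a parameter to allow recursion on the word; l = `⊤⁺` gives `M`.
  peaksAfter : ∀ {n} → Fin k ⁺ → Vec (Fin k) n → ℕ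
  peaksAfter l xs = tally λ i →
    (lookup (l ∷ pad xs) (inject₁ (inject₁ i)) <⁺ᵇ lookup (pad xs) (inject₁ i))
    ∧ (lookup (pad xs) (suc i) <⁺ᵇ lookup (pad xs) (inject₁ i))

  -- Each entry of `peaks` stands for one ascent and one descent. A pending ascent into a adds
  -- `bit up` to the ascents, and makes a a peak if a descent follows.
  walk-stats : ∀ {n} up a (xs : Vec (Fin k) n) → Unique (a ∷ xs) →
    let P = walk up (toℕ a) (Vec.map toℕ xs) in
      rises P ℕ.+ peaks P ≡ bit up ℕ.+ ascents (a ∷ xs)
    × falls P ℕ.+ peaks P ≡ descents (a ∷ xs)
    × peaks P ≡ bit (up ∧ (lookup (pad xs) zero <⁺ᵇ [ a ])) ℕ.+ peaksAfter [ a ] xs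
  walk-stats true  a [] _ = ≡.refl , ≡.refl , ≡.refl
  walk-stats false a [] _ = ≡.refl , ≡.refl , ≡.refl
  walk-stats up a (b ∷ xs) ((a≢b ∷ _) ∷ u) with ℕ.<-cmp (toℕ a) (toℕ b)
  ... | tri≈ _ a≡b _ = contradiction (Fin.toℕ-injective a≡b) a≢b
  ... | tri< a<b _ _ rewrite <ᵇ-true a<b | <ᵇ-false (ℕ.<⇒≤ a<b) =
    let r , f , p = walk-stats true b xs u in lemma up r f p
    where
    w = walk true (toℕ b) (Vec.map toℕ xs)
    lemma : ∀ up {x y z} → rises w ℕ.+ peaks w ≡ suc x → falls w ℕ.+ peaks w ≡ y → peaks w ≡ z →
      rises (ascend up w) ℕ.+ peaks (ascend up w) ≡ bit up ℕ.+ suc x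
      × falls (ascend up w) ℕ.+ peaks (ascend up w) ≡ y
      × peaks (ascend up w) ≡ bit (up ∧ false) ℕ.+ z
    lemma true  r f p = ≡.cong suc r , f , p
    lemma false r f p = r , f , p
  ... | tri> _ _ b<a rewrite <ᵇ-true b<a | <ᵇ-false (ℕ.<⇒≤ b<a) =
    let r , f , p = walk-stats false b xs u in lemma up r f p
    where
    w = walk false (toℕ b) (Vec.map toℕ xs)
    lemma : ∀ up {x y z} → rises w ℕ.+ peaks w ≡ x → falls w ℕ.+ peaks w ≡ y → peaks w ≡ z →
      rises (descend up w) ℕ.+ peaks (descend up w) ≡ bit up ℕ.+ x
      × falls (descend up w) ℕ.+ peaks (descend up w) ≡ suc y
      × peaks (descend up w) ≡ bit (up ∧ true) ℕ.+ z
    lemma true  r f p = ≡.trans (ℕ.+-suc _ _) (≡.cong suc r) , ≡.trans (ℕ.+-suc _ _) (≡.cong suc f) , ≡.cong suc p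
    lemma false r f p = r , ≡.cong suc f , p

  isMin⇔ : ∀ {n} a (xs : Vec (Fin k) n) → T (isMin a (Vec.map toℕ xs)) ⇔ (∀ j → a ℕ.< toℕ (lookup xs j))
  isMin⇔ a xs = mk⇔ (to xs) (from xs)
    where
    to : ∀ {n} (xs : Vec (Fin k) n) → T (isMin a (Vec.map toℕ xs)) → ∀ j → a ℕ.< toℕ (lookup xs j)
    to (x ∷ xs) min zero    = ℕ.<ᵇ⇒< a (toℕ x) (proj₁ (Equivalence.to T-∧ min))
    to (x ∷ xs) min (suc j) = to xs (proj₂ (Equivalence.to (T-∧ {a <ᵇ toℕ x}) min)) j
    from : ∀ {n} (xs : Vec (Fin k) n) → (∀ j → a ℕ.< toℕ (lookup xs j)) → T (isMin a (Vec.map toℕ xs))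
    from []       _   = _
    from (x ∷ xs) min = Equivalence.from T-∧ (ℕ.<⇒<ᵇ (min zero) , from xs (min ∘ suc))

  rlMins-∷ : ∀ {n} x (xs : Vec (Fin k) n) →
             rlMins (x ∷ xs) ≡ bit (isMin (toℕ x) (Vec.map toℕ xs)) ℕ.+ rlMins xs
  rlMins-∷ x xs = ≡.cong₂ ℕ._+_
    (≡.cong bit (does-⇔ (mk⇔
      (λ min → Equivalence.from (isMin⇔ (toℕ x) xs) (λ j → min (suc j) z<s))
      (λ { min (suc j) _ → Equivalence.to (isMin⇔ (toℕ x) xs) min j }))
      (rlMin? (x ∷ xs) zero) (T? (isMin (toℕ x) (Vec.map toℕ xs)))))
    (tally-cong λ i → does-⇔ (mk⇔
      (λ min j j>i → min (suc j) (s<s j>i))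
      (λ { min (suc j) j>i → min j (s<s⁻¹ j>i) }))
      (rlMin? (x ∷ xs) (suc i)) (rlMin? xs i))

  -- The starting letter a is not counted by `walk`, and neither `ascend` nor `descend` changes
  -- `rlmins`.
  rlmins-walk : ∀ {n} up a (xs : Vec (Fin k) n) → rlmins (walk up a (Vec.map toℕ xs)) ≡ rlMins xs
  rlmins-walk up a []       = ≡.refl
  rlmins-walk up a (b ∷ xs) = ≡.trans (ℕ.+-comm _ (bit (isMin (toℕ b) (Vec.map toℕ xs))))
    (≡.trans (≡.cong (bit (isMin (toℕ b) (Vec.map toℕ xs)) ℕ.+_) (lemma up (a <ᵇ toℕ b)))
      (≡.sym (rlMins-∷ b xs)))
    where
    ys = Vec.map toℕ xs
    lemma : ∀ up a<ᵇb →
      rlmins (if a<ᵇb then ascend up (walk true (toℕ b) ys) else descend up (walk false (toℕ b) ys))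
      ≡ rlMins xs
    lemma true  true  = rlmins-walk true (toℕ b) xs
    lemma true  false = rlmins-walk false (toℕ b) xs
    lemma false true  = rlmins-walk true (toℕ b) xs
    lemma false false = rlmins-walk false (toℕ b) xs

  -- The new first letter x is itself a left-to-right minimum and rules out no later one, since
  -- those are at most y.
  lrMins-∷-> : ∀ {n} x y (xs : Vec (Fin k) n) → y < x → lrMins (x ∷ y ∷ xs) ≡ suc (lrMins (y ∷ xs))
  lrMins-∷-> x y xs y<x = ≡.cong₂ ℕ._+_
    (≡.cong bit (dec-true (lrMin? (x ∷ y ∷ xs) zero) (λ _ ())))
    (tally-cong λ i → does-⇔ (mk⇔
      (λ min j j<i → min (suc j) (s<s j<i))
      (λ { min zero    _   → first i min
         ; min (suc j) j<i → min j (s<s⁻¹ j<i) }))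
      (lrMin? (x ∷ y ∷ xs) (suc i)) (lrMin? (y ∷ xs) i))
    where
    first : ∀ i → (∀ j → j < i → lookup (y ∷ xs) j > lookup (y ∷ xs) i) → x > lookup (y ∷ xs) i
    first zero    min = y<x
    first (suc i) min = ℕ.<-trans (min zero z<s) y<x

-- Words with the letter 1: minima and the first ascent

module _ {k : ℕ} where

  lrMins-zero : ∀ {n} (xs : Vec (Fin (suc k)) n) → lrMins (zero ∷ xs) ≡ 1
  lrMins-zero xs = ≡.cong₂ ℕ._+_
    (≡.cong bit (dec-true (lrMin? (zero ∷ xs) zero) (λ _ ())))
    (tally-false λ i → dec-false (lrMin? (zero ∷ xs) (suc i)) λ min → contradiction (min zero z<s) λ ())

  isMin-zero : ∀ {n} (xs : Vec (Fin (suc k)) n) → All (zero ≢_) xs → isMin 0 (Vec.map toℕ xs) ≡ true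
  isMin-zero []           []        = ≡.refl
  isMin-zero (zero  ∷ xs) (0≢0 ∷ _) = contradiction ≡.refl 0≢0
  isMin-zero (suc _ ∷ xs) (_ ∷ 0∉)  = isMin-zero xs 0∉

  isMin-suc : ∀ {n} a (xs : Vec (Fin (suc k)) n) i → lookup xs i ≡ zero → isMin (suc a) (Vec.map toℕ xs) ≡ false
  isMin-suc a xs i xᵢ≡0 = dec-false (T? (isMin (suc a) (Vec.map toℕ xs))) λ min →
    contradiction (≡.subst (λ x → suc a ℕ.< toℕ x) xᵢ≡0 (Equivalence.to (isMin⇔ (suc a) xs) min i)) λ ()

  module _ {m} (xs : Vec (Fin (suc k)) (suc m)) where

    IsAscent : Pred (Fin m) 0ℓ
    IsAscent i = lookup xs (inject₁ i) < lookup xs (suc i)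

    IsFirstAscent : Pred (Fin m) 0ℓ
    IsFirstAscent i = IsAscent i × (∀ j → j < i → ¬ IsAscent j)

    FirstAscentAtZero : Set
    FirstAscentAtZero = ∀ i → IsFirstAscent i → lookup xs (inject₁ i) ≡ zero

  -- The letter after an initial `zero` is larger, so the first ascent is already at position
  -- `zero`.
  firstAscentAtZero-zero : ∀ {m} (xs : Vec (Fin (suc k)) m) → All (zero ≢_) xs →
                           FirstAscentAtZero (zero ∷ xs)
  firstAscentAtZero-zero xs           _         zero    _           = ≡.refl
  firstAscentAtZero-zero (zero  ∷ xs) (0≢0 ∷ _) (suc i) _           = contradiction ≡.refl 0≢0
  firstAscentAtZero-zero (suc x ∷ xs) _         (suc i) (_ , first) = contradiction z<s (first zero z<s)

  firstAscentAtZero-> : ∀ {m x y} {xs : Vec (Fin (suc k)) m} → y < x →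
                        FirstAscentAtZero (x ∷ y ∷ xs) ⇔ FirstAscentAtZero (y ∷ xs)
  firstAscentAtZero-> y<x = mk⇔
    (λ fa i (asc , first) → fa (suc i) (asc , λ { zero    _   → ℕ.<-asym y<x
                                                ; (suc j) j<i → first j (s<s⁻¹ j<i) }))
    (λ { fa zero    (asc , _)     → contradiction asc (ℕ.<-asym y<x)
       ; fa (suc i) (asc , first) → fa i (asc , λ j j<i → first (suc j) (s<s j<i)) })

  ¬firstAscentAtZero-< : ∀ {m x y} {xs : Vec (Fin (suc k)) m} → suc x < y →
                         ¬ FirstAscentAtZero (suc x ∷ y ∷ xs)
  ¬firstAscentAtZero-< x<y fa = contradiction (fa zero (x<y , λ _ ())) λ ()

-- Pigeonhole again: if `zero` were missing, punching it out would inject n + 1 positions into n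
-- letters.
zero∈permutation : ∀ {n} {σ : Word (suc n)} → IsPermutation σ → ∃ λ i → lookup σ i ≡ zero
zero∈permutation {σ = σ} u with Fin.any? (λ i → lookup σ i Fin.≟ zero)
... | yes 0∈ = 0∈
... | no  ∉  = contradiction
  (Fin.injective⇒≤ {f = λ i → Fin.punchOut (σᵢ≢0 i)} λ {i} {j} eq →
    Unique.lookup-injective u i j (Fin.punchOut-injective (σᵢ≢0 i) (σᵢ≢0 j) eq))
  (ℕ.<-irrefl ≡.refl)
  where
  σᵢ≢0 : ∀ i → zero ≢ lookup σ i
  σᵢ≢0 i 0≡σᵢ = ∉ (i , ≡.sym 0≡σᵢ)

-- Weights as monomials in the statistics, and the sum over PRW

module Weights {c ℓ} (R : CommutativeRing c ℓ) where

  open RingNotation R hiding (zero)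
  open Derivation R
  open Insertion R
  open PermutationSums R
  open import Algebra.Properties.Semiring.Exp semiring using (^-homo-*; ^-congʳ)
  open import Algebra.Properties.CommutativeSemiring.Exp commutativeSemiring using (^-distrib-*)
  open import Algebra.Solver.Ring.NaturalCoefficients.Default commutativeSemiring
    using (solve; _:=_; _:*_; con)
  open import Relation.Binary.Reasoning.Setoid setoid

  module _ (t : Carrier) (φ : Profile → Carrier) where

    -- The statistics of a word D 1 R with D decreasing of length d.
    record Decomposition {k m} (xs : Vec (Fin (suc k)) (suc m)) : Set ℓ where
      field
        d         : ℕ
        P         : Profile
        ascents≡  : ascents xs ≡ rises P ℕ.+ peaks P
        descents≡ : descents xs ≡ d ℕ.+ (falls P ℕ.+ peaks P)
        peaks≡    : peaksAfter ⊤⁺ xs ≡ peaks P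
        lrMins≡   : lrMins xs ≡ suc d
        rlMins≡   : rlMins xs ≡ suc (rlmins P)
        weight≈   : weight t φ (Vec.map toℕ xs) ≈ t ^ d * φ P

    -- Letters of D are peeled off until `zero` or an ascent is met. Suffixes of permutations occur
    -- in the recursion, so the word is only assumed to have distinct letters and to contain `zero`.
    decompose : ∀ {k m} (xs : Vec (Fin (suc k)) (suc m)) → Unique xs → (∃ λ i → lookup xs i ≡ zero) →
                (FirstAscentAtZero xs × Decomposition xs)
                ⊎ (¬ FirstAscentAtZero xs × weight t φ (Vec.map toℕ xs) ≈ 0#)
    decompose (zero ∷ xs) (0∉ ∷ u) _ =
      let r , f , p = walk-stats false zero xs (0∉ ∷ u) in
      inj₁ (firstAscentAtZero-zero xs 0∉ , record
        { d = 0
        ; P = walk false 0 (Vec.map toℕ xs)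
        ; ascents≡ = ≡.sym r
        ; descents≡ = ≡.sym f
        ; peaks≡ = ≡.sym p
        ; lrMins≡ = lrMins-zero xs
        ; rlMins≡ = ≡.trans (rlMins-∷ zero xs) (≡.cong₂ (λ m r → bit m ℕ.+ r)
            (isMin-zero xs 0∉) (≡.sym (rlmins-walk false 0 xs)))
        ; weight≈ = sym (*-identityˡ _)
        })
    decompose (suc x ∷ []) _ (zero , ())
    decompose (suc x ∷ y ∷ xs) _ (zero , ())
    decompose (suc x ∷ y ∷ xs) ((x≢y ∷ _) ∷ u) (suc i , eq) with ℕ.<-cmp (suc (toℕ x)) (toℕ y)
    ... | tri≈ _ x≡y _ = contradiction (Fin.toℕ-injective x≡y) x≢y
    ... | tri< x<y _ _ = inj₂ (¬firstAscentAtZero-< x<y ,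
      reflexive (≡.cong (λ c → if c then t * weight t φ (Vec.map toℕ (y ∷ xs)) else 0#) (<ᵇ-false (ℕ.<⇒≤ x<y))))
    ... | tri> _ _ y<x with decompose (y ∷ xs) u (i , eq)
    ...   | inj₂ (¬fa , w≈0) = inj₂ (¬fa ∘ Equivalence.to (firstAscentAtZero-> y<x) ,
      trans (reflexive (≡.cong (λ c → if c then t * weight t φ (Vec.map toℕ (y ∷ xs)) else 0#) (<ᵇ-true y<x)))
            (trans (*-congˡ w≈0) (zeroʳ t)))
    ...   | inj₁ (fa , D) = inj₁ (Equivalence.from (firstAscentAtZero-> y<x) fa , record
      { d = suc d
      ; P = P
      ; ascents≡ = ≡.trans (≡.cong (λ b → bit b ℕ.+ ascents (y ∷ xs)) (<ᵇ-false (ℕ.<⇒≤ y<x))) ascents≡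
      ; descents≡ = ≡.cong₂ (λ b m → bit b ℕ.+ m) (<ᵇ-true y<x) descents≡
      -- After the descent from `suc x`, y cannot be a peak, just as after `⊤⁺`.
      ; peaks≡ = ≡.trans (≡.cong (λ b → bit (b ∧ (lookup (pad xs) zero <⁺ᵇ [ y ])) ℕ.+ peaksAfter [ y ] xs) (<ᵇ-false {suc (toℕ x)} (ℕ.<⇒≤ y<x))) peaks≡
      ; lrMins≡ = ≡.trans (lrMins-∷-> (suc x) y xs y<x) (≡.cong suc lrMins≡)
      -- The `zero` further right keeps `suc x` from being a right-to-left minimum.
      ; rlMins≡ = ≡.trans (rlMins-∷ (suc x) (y ∷ xs))
          (≡.trans (≡.cong (λ b → bit b ℕ.+ rlMins (y ∷ xs)) (isMin-suc (toℕ x) (y ∷ xs) i eq)) rlMins≡)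
      ; weight≈ = trans (reflexive (≡.cong (λ c → if c then t * weight t φ (Vec.map toℕ (y ∷ xs)) else 0#) (<ᵇ-true y<x)))
            (trans (*-congˡ weight≈) (sym (*-assoc _ _ _)))
      })
      where open Decomposition D

  monomial : (u v w α : Carrier) → ∀ {m} → Word (suc m) → Carrier
  monomial u v w α σ = u ^ M σ * v ^ des σ * w ^ asc σ * α ^ (LRmin σ ℕ.+ RLmin σ ∸ 2)

  module _ (u v w α : Carrier) where

    private φ = profileWeight α v w (u * v * w) 0

    monomial-decomposition : ∀ {m} (σ : Word (suc m)) (D : Decomposition (α * v) φ σ) →
                             monomial u v w α σ ≈ weight (α * v) φ (Vec.map toℕ σ)
    monomial-decomposition σ D = begin
      u ^ M σ * v ^ des σ * w ^ asc σ * α ^ (LRmin σ ℕ.+ RLmin σ ∸ 2)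
        ≈⟨ *-cong (*-cong (*-cong
             (^-congʳ u (≡.trans (#-tally (isPeak? σ)) peaks≡))
             (^-congʳ v (≡.trans (#-tally (descent? σ)) descents≡)))
             (^-congʳ w (≡.trans (#-tally (ascent? σ)) ascents≡)))
             -- The truncated subtraction is harmless: the letter 1 accounts for one minimum of each
             -- kind, which leaves d + r.
             (^-congʳ α (≡.trans (≡.cong₂ (λ l r → l ℕ.+ r ∸ 2)
                (≡.trans (#-tally (isLRmin? σ)) lrMins≡)
                (≡.trans (#-tally (isRLmin? σ)) rlMins≡))
                (≡.cong (_∸ 1) (ℕ.+-suc d r)))) ⟩
      u ^ k * v ^ (d ℕ.+ (j ℕ.+ k)) * w ^ (i ℕ.+ k) * α ^ (d ℕ.+ r)
        ≈⟨ *-cong (*-cong (*-congˡ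
             (trans (^-homo-* v d (j ℕ.+ k)) (*-congˡ (^-homo-* v j k))))
             (^-homo-* w i k))
             (^-homo-* α d r) ⟩
      u ^ k * (v ^ d * (v ^ j * v ^ k)) * (w ^ i * w ^ k) * (α ^ d * α ^ r)
        ≈⟨ solve 8 (λ uᵏ vᵈ vʲ vᵏ wⁱ wᵏ αᵈ αʳ →
             uᵏ :* (vᵈ :* (vʲ :* vᵏ)) :* (wⁱ :* wᵏ) :* (αᵈ :* αʳ) :=
             αᵈ :* vᵈ :* (αʳ :* (con 1 :* con 1 :* wⁱ :* vʲ :* (uᵏ :* vᵏ :* wᵏ))))
             refl (u ^ k) (v ^ d) (v ^ j) (v ^ k) (w ^ i) (w ^ k) (α ^ d) (α ^ r) ⟩
      α ^ d * v ^ d * (α ^ r * (1# * 1# * w ^ i * v ^ j * (u ^ k * v ^ k * w ^ k)))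
        ≈⟨ *-cong (^-distrib-* α v d) (*-congˡ (*-congˡ
             (trans (^-distrib-* (u * v) w k) (*-congʳ (^-distrib-* u v k))))) ⟨
      (α * v) ^ d * φ P
        ≈⟨ weight≈ ⟨
      weight (α * v) φ (Vec.map toℕ σ) ∎
      where
      open Decomposition D
      i = rises P
      j = falls P
      k = peaks P
      r = rlmins P

    -- By `decompose` the filter may be dropped: permutations outside PRW have weight 0.
    ∑-PRW : ∀ n → (∑[ σ ∈ PRW (suc n) ] monomial u v w α σ)
                  ≈ iter α (α * v + α * w) (w + v) w v (u * v * w) n 0 0 0 0 0
    ∑-PRW n = begin
      (∑[ σ ∈ PRW (suc n) ] monomial u v w α σ)
        ≈⟨ ∑-filter firstAscentAt1? (𝔖 (suc n)) _ ⟩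
      (∑[ σ ∈ 𝔖 (suc n) ] (if does (firstAscentAt1? σ) then monomial u v w α σ else 0#))
        ≈⟨ ∑-cong (𝔖 (suc n)) (λ σ σ∈ → pointwise σ (∈-𝔖⁻ σ∈)) ⟩
      (∑[ σ ∈ 𝔖 (suc n) ] weight (α * v) φ (Vec.map toℕ σ))
        ≈⟨ ∑-permutations α v w (u * v * w) n 0 ⟩
      iter α (α * v + α * w) (w + v) w v (u * v * w) (n ℕ.+ 0) 0 0 0 0 0
        ≡⟨ ≡.cong (λ n → iter α (α * v + α * w) (w + v) w v (u * v * w) n 0 0 0 0 0) (ℕ.+-identityʳ n) ⟩
      iter α (α * v + α * w) (w + v) w v (u * v * w) n 0 0 0 0 0 ∎
      where
      pointwise : ∀ (σ : Word (suc n)) → IsPermutation σ →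
        (if does (firstAscentAt1? σ) then monomial u v w α σ else 0#) ≈ weight (α * v) φ (Vec.map toℕ σ)
      pointwise σ uσ with decompose (α * v) φ σ uσ (zero∈permutation uσ)
      ... | inj₁ (fa , D)    rewrite dec-true  (firstAscentAt1? σ) fa  = monomial-decomposition σ D
      ... | inj₂ (¬fa , w≈0) rewrite dec-false (firstAscentAt1? σ) ¬fa = sym w≈0

  -- S = α (w + v) is determined by α and w + v, so `iter-cong` applies.
  ∑-PRW-cong : ∀ {u v w u′ v′ w′ α} → w + v ≈ w′ + v′ → u * v * w ≈ u′ * v′ * w′ → ∀ n →
    (∑[ σ ∈ PRW (suc n) ] monomial u v w α σ) ≈ (∑[ σ ∈ PRW (suc n) ] monomial u′ v′ w′ α σ)
  ∑-PRW-cong {u} {v} {w} {u′} {v′} {w′} {α} s≈ p≈ n = begin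
    (∑[ σ ∈ PRW (suc n) ] monomial u v w α σ)
      ≈⟨ ∑-PRW u v w α n ⟩
    iter α (α * v + α * w) (w + v) w v (u * v * w) n 0 0 0 0 0
      ≈⟨ iter-cong (begin
           α * v + α * w   ≈⟨ +-comm _ _ ⟩
           α * w + α * v   ≈⟨ distribˡ α w v ⟨
           α * (w + v)     ≈⟨ *-congˡ s≈ ⟩
           α * (w′ + v′)   ≈⟨ distribˡ α w′ v′ ⟩
           α * w′ + α * v′ ≈⟨ +-comm _ _ ⟩
           α * v′ + α * w′ ∎) s≈ p≈ n 0 0 0 ⟩
    iter α (α * v′ + α * w′) (w′ + v′) w′ v′ (u′ * v′ * w′) n 0 0 0 0 0
      ≈⟨ ∑-PRW u′ v′ w′ α n ⟨
    (∑[ σ ∈ PRW (suc n) ] monomial u′ v′ w′ α σ) ∎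

-- Specialisation to the two roots

theorem2p2 : ∀ {c ℓ} (R : CommutativeRing c ℓ) → let open RingNotation R in
    (½ : Carrier) → 2 · ½ ≈ 1# →
    (u v w α √Δ : Carrier) → √Δ ^ 2 ≈ (w + v) ^ 2 - 4 · (u * v * w) →
    let x = ((w + v) - √Δ) * ½
        y = ((w + v) + √Δ) * ½
    in
    (n : ℕ) → n ℕ.≥ 1 →
    (∑[ σ ∈ PRW (suc n) ] (u ^ M σ * v ^ des σ * w ^ asc σ * α ^ (LRmin σ ℕ.+ RLmin σ ∸ 2)))
      ≈ (∑[ σ ∈ PRW (suc n) ] (x ^ des σ * y ^ asc σ * α ^ (LRmin σ ℕ.+ RLmin σ ∸ 2)))
theorem2p2 R ½ 2½≈1 u v w α √Δ √Δ²≈ n _ = begin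
  (∑[ σ ∈ PRW (suc n) ] monomial u v w α σ)
    ≈⟨ ∑-PRW-cong s≈ p≈ n ⟩
  (∑[ σ ∈ PRW (suc n) ] monomial 1# x y α σ)
    ≈⟨ ∑-cong (PRW (suc n)) (λ σ _ → *-congʳ (*-congʳ (trans (*-congʳ (1^ (M σ))) (*-identityˡ _)))) ⟩
  (∑[ σ ∈ PRW (suc n) ] (x ^ des σ * y ^ asc σ * α ^ (LRmin σ ℕ.+ RLmin σ ∸ 2))) ∎
  where
  open RingNotation R hiding (zero)
  open PermutationSums R
  open Weights R
  open import Algebra.Solver.Ring.NaturalCoefficients.Default commutativeSemiring
    using (solve; _:=_; _:+_; _:*_; con)
  open import Relation.Binary.Reasoning.Setoid setoid

  s = w + v
  x = (s - √Δ) * ½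
  y = (s + √Δ) * ½
  q = u * v * w

  1^ : ∀ n → 1# ^ n ≈ 1#
  1^ zero    = refl
  1^ (suc n) = trans (*-identityˡ _) (1^ n)

  -- By Vieta, x and y are the roots of X² - s X + q; this is their sum, and `p≈` gives their
  -- product.
  s≈ : w + v ≈ y + x
  s≈ = sym (begin
    (s + √Δ) * ½ + (s - √Δ) * ½
      -- In the semiring identity m stands for `- √Δ`; d + m is split off to be cancelled next. The
      -- zero comes from unfolding `2 · ½`.
      ≈⟨ solve 4 (λ s d m h → (s :+ d) :* h :+ (s :+ m) :* h := s :* (h :+ (h :+ con 0)) :+ (d :+ m) :* h)
           refl s √Δ (- √Δ) ½ ⟩
    s * (2 · ½) + (√Δ - √Δ) * ½
      ≈⟨ +-cong (*-congˡ 2½≈1) (*-congʳ (-‿inverseʳ √Δ)) ⟩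
    s * 1# + 0# * ½
      ≈⟨ +-cong (*-identityʳ s) (zeroˡ ½) ⟩
    s + 0#
      ≈⟨ +-identityʳ s ⟩
    s ∎)

  p≈ : u * v * w ≈ 1# * x * y
  p≈ = sym (begin
    1# * ((s - √Δ) * ½) * ((s + √Δ) * ½)
      ≈⟨ solve 4 (λ s d m h →
           con 1 :* ((s :+ m) :* h) :* ((s :+ d) :* h) :=
           (s :* s :+ (d :+ m) :* s :+ m :* d) :* (h :* h))
           refl s √Δ (- √Δ) ½ ⟩
    (s * s + (√Δ - √Δ) * s + - √Δ * √Δ) * (½ * ½)
      ≈⟨ *-congʳ (+-congʳ (trans (+-congˡ (trans (*-congʳ (-‿inverseʳ √Δ)) (zeroˡ s))) (+-identityʳ _))) ⟩
    (s * s + - √Δ * √Δ) * (½ * ½)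
      ≈⟨ *-congʳ numerator ⟩
    4 · q * (½ * ½)
      ≈⟨ solve 2 (λ q h → (q :+ (q :+ (q :+ (q :+ con 0)))) :* (h :* h) :=
           q :* ((h :+ (h :+ con 0)) :* (h :+ (h :+ con 0)))) refl q ½ ⟩
    q * ((2 · ½) * (2 · ½))
      ≈⟨ *-congˡ (*-cong 2½≈1 2½≈1) ⟩
    q * (1# * 1#)
      ≈⟨ trans (*-congˡ (*-identityˡ 1#)) (*-identityʳ q) ⟩
    q ∎)
    where
    numerator : s * s + - √Δ * √Δ ≈ 4 · q
    numerator = begin
      s * s + - √Δ * √Δ
        -- Adding and subtracting 4 q exposes the discriminant in s², so that it can be replaced by
        -- the square of `√Δ`.
        ≈⟨ +-congʳ (begin
             s * s
               ≈⟨ +-identityʳ _ ⟨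
             s * s + 0#
               ≈⟨ +-congˡ (-‿inverseˡ (4 · q)) ⟨
             s * s + (- (4 · q) + 4 · q)
               ≈⟨ solve 3 (λ s a b → s :* s :+ (a :+ b) := s :* (s :* con 1) :+ a :+ b) refl s (- (4 · q)) (4 · q) ⟩
             s ^ 2 - 4 · q + 4 · q
               ≈⟨ +-congʳ √Δ²≈ ⟨
             √Δ ^ 2 + 4 · q ∎) ⟩
      √Δ * (√Δ * 1#) + 4 · q + - √Δ * √Δ
        ≈⟨ solve 3 (λ d m q → d :* (d :* con 1) :+ q :+ m :* d := (d :+ m) :* d :+ q) refl √Δ (- √Δ) (4 · q) ⟩
      (√Δ - √Δ) * √Δ + 4 · q
        ≈⟨ +-congʳ (trans (*-congʳ (-‿inverseʳ √Δ)) (zeroˡ √Δ)) ⟩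
      0# + 4 · q
        ≈⟨ +-identityˡ _ ⟩
      4 · q ∎
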